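{- Let $A$ be a bounded distributive lattice with Priestley space $X$, and let $S\subseteq A$ be such that $\bigvee_A S$ exists. Then $\bigvee_A S$ is distributive if and only if $\mathfrak s(\bigvee_A S)={\sf cl}\bigcup_{s\in S}\mathfrak s(s)$.
   Context: A join $\bigvee_A S$ is distributive if $a\wedge\bigvee_A S=\bigvee_A\{a\wedge s:s\in S\}$ for all $a\in A$. The Priestley space $X$ of $A$ is the set of prime filters of $A$ ordered by inclusion, with topology generated by the basis $\{\mathfrak s(a)\setminus\mathfrak s(b):a,b\in A\}$, where $\mathfrak s(a)=\{x\in X:a\in x\}$; ${\sf cl}$ denotes topological closure in $X$. -}

module Defs where

open import Level using (Level; _⊔_; suc)
open import Data.Product using (_×_; _,_; ∃; Σ; proj₁)
open import Data.Sum using (_⊎_)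
open import Relation.Binary.Core using (Rel)
open import Relation.Binary.Lattice using (BoundedLattice)
open import Relation.Unary using (Pred; _∈_; _∉_; _⊆_; _∖_; ∁)
import Algebra.Definitions as Definitions

record BoundedDistributiveLattice c ℓ₁ ℓ₂ : Set (suc (c ⊔ ℓ₁ ⊔ ℓ₂)) where
  field
    boundedLattice : BoundedLattice c ℓ₁ ℓ₂

  open BoundedLattice boundedLattice public
  open Definitions _≈_ using (_DistributesOverˡ_)

  field
    ∧-distribˡ-∨ : _∧_ DistributesOverˡ _∨_

-- The topology on X having the family B as a basis.  That B really is a
-- basis is not assumed here; `IsOpen` says that a set is a union of members
-- of B.

module TopologyFromBasis {x i b : Level} {X : Set x} {I : Set i}
                         (B : I → Pred X b) where

  IsOpen : ∀ {r} → Pred X r → Set (x ⊔ i ⊔ b ⊔ r)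
  IsOpen U = ∀ {p} → p ∈ U → ∃ λ k → p ∈ B k × B k ⊆ U

  IsClosed : ∀ {r} → Pred X r → Set (x ⊔ i ⊔ b ⊔ r)
  IsClosed C = IsOpen (∁ C)

  -- The intersection of all closed sets containing Z.

  cl : ∀ {r} → Pred X r → Pred X (x ⊔ i ⊔ b ⊔ suc r)
  cl {r} Z p = (C : Pred X r) → IsClosed C → Z ⊆ C → p ∈ C

module _ {c ℓ₁ ℓ₂ : Level} (A : BoundedDistributiveLattice c ℓ₁ ℓ₂) where

  open BoundedDistributiveLattice A

  IsJoin : ∀ {r} → Pred Carrier r → Carrier → Set (c ⊔ ℓ₂ ⊔ r)
  IsJoin S j = (∀ {s} → s ∈ S → s ≤ j)
             × (∀ {u} → (∀ {s} → s ∈ S → s ≤ u) → j ≤ u)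

  -- The set {a ∧ s : s ∈ S}.

  meetWith : ∀ {r} → Carrier → Pred Carrier r → Pred Carrier (c ⊔ ℓ₁ ⊔ r)
  meetWith a S y = ∃ λ s → s ∈ S × y ≈ a ∧ s

  -- For j a join of S.  The equation a ∧ j = ⋁ {a ∧ s : s ∈ S} includes
  -- the existence of its right-hand side.

  IsDistributive : ∀ {r} → Pred Carrier r → Carrier → Set (c ⊔ ℓ₁ ⊔ ℓ₂ ⊔ r)
  IsDistributive S j = ∀ a → IsJoin (meetWith a S) (a ∧ j)

  -- Prime filters are proper.  Upward closure makes F respect _≈_.

  record IsPrimeFilter {r} (F : Pred Carrier r) : Set (c ⊔ ℓ₂ ⊔ r) where
    field
      ⊤-mem    : ⊤ ∈ F
      upward   : ∀ {a b} → a ≤ b → a ∈ F → b ∈ F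
      ∧-closed : ∀ {a b} → a ∈ F → b ∈ F → a ∧ b ∈ F
      proper   : ⊥ ∉ F
      prime    : ∀ {a b} → a ∨ b ∈ F → a ∈ F ⊎ b ∈ F

  PriestleySpace : Set (suc (c ⊔ ℓ₁ ⊔ ℓ₂))
  PriestleySpace = Σ (Pred Carrier (c ⊔ ℓ₁ ⊔ ℓ₂)) IsPrimeFilter

  _⊑_ : Rel PriestleySpace (c ⊔ ℓ₁ ⊔ ℓ₂)
  x ⊑ y = proj₁ x ⊆ proj₁ y

  𝔰 : Carrier → Pred PriestleySpace (c ⊔ ℓ₁ ⊔ ℓ₂)
  𝔰 a x = a ∈ proj₁ x

  basic : Carrier × Carrier → Pred PriestleySpace (c ⊔ ℓ₁ ⊔ ℓ₂)
  basic (a , b) = 𝔰 a ∖ 𝔰 b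

  open TopologyFromBasis basic public

{-# OPTIONS --safe #-}

-- Prime filters separate: if a ≰ b, some prime filter contains a and omits b.
-- It is a maximal filter containing a and omitting b, given by Zorn's lemma.
-- Consequently 𝔰 a ∩ 𝔰 s ⊆ 𝔰 b exactly when a ∧ s ≤ b.  A basic open set
-- 𝔰 a ∖ 𝔰 b thus misses every 𝔰 s iff b is an upper bound of {a ∧ s : s ∈ S},
-- and it misses 𝔰 (⋁S) iff a ∧ ⋁S ≤ b.  Both conditions of the theorem say
-- that the former implies the latter for all a and b.
--
-- Zorn's lemma is proved by the Bourbaki–Witt tower argument.  Subsets are
-- represented as Bool-valued functions: under excluded middle this loses no
-- subsets, it keeps families of subsets in the same universe, and with
-- function extensionality mutual inclusion becomes propositional equality.

module Submission where

open import Defs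
open import Level using (Level; _⊔_; suc; 0ℓ; Lift; lift; lower)
open import Data.Bool.Base using (Bool; true)
open import Data.Bool.Properties using (⇔→≡)
open import Data.Product using (∃; _×_; _,_; proj₁; proj₂)
open import Data.Sum using (_⊎_; inj₁; inj₂; [_,_])
open import Function.Base using (_∘_; id)
open import Function.Bundles using (_⇔_; mk⇔)
open import Relation.Binary.Bundles using (Poset)
open import Relation.Binary.PropositionalEquality using (_≡_; refl; subst)
open import Relation.Nullary using (Dec; yes; no; does; ¬_; contradiction)
open import Relation.Nullary.Decidable using (map′; decidable-stable; dec-true)
open import Relation.Unary using (Pred; Decidable; Satisfiable; _∈_; _∉_; _⊆_; _≐_; ⋃; ∁)
open import Axiom.ExcludedMiddle using (ExcludedMiddle)
open import Axiom.Extensionality.Propositional using (Extensionality; lower-extensionality)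
import Relation.Binary.Lattice.Properties.MeetSemilattice as MeetSemilatticeProperties

-- Excluded middle and Boolean-valued subsets.

lower-excludedMiddle : ∀ a b → ExcludedMiddle (a ⊔ b) → ExcludedMiddle a
lower-excludedMiddle a b em {P} = map′ lower lift (em {Lift b P})

Subset : ∀ {x} → Set x → Set x
Subset X = X → Bool

⟦_⟧ : ∀ {x} {X : Set x} → Subset X → Pred X 0ℓ
⟦ p ⟧ x = p x ≡ true

comprehension : ∀ {x r} {X : Set x} {P : Pred X r} (P? : Decidable P) → ⟦ does ∘ P? ⟧ ≐ P
comprehension {P = P} P? = (λ {x} → witness (P? x)) , (λ {x} → dec-true (P? x))
  where
  witness : ∀ {x} (d : Dec (P x)) → does d ≡ true → P x
  witness (yes p) _ = p

module _ {x : Level} {X : Set x} where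

  infix 4 _≼_

  _≼_ : Subset X → Subset X → Set x
  p ≼ q = ⟦ p ⟧ ⊆ ⟦ q ⟧

  ≼-antisym : Extensionality x 0ℓ → ∀ {p q} → p ≼ q → q ≼ p → p ≡ q
  ≼-antisym ext p≼q q≼p = ext λ _ → ⇔→≡ (mk⇔ p≼q q≼p)

  IsChain : Subset (Subset X) → Set x
  IsChain Φ = ∀ {p q} → p ∈ ⟦ Φ ⟧ → q ∈ ⟦ Φ ⟧ → p ≼ q ⊎ q ≼ p

  IsUnion : Subset (Subset X) → Subset X → Set x
  IsUnion Φ u = ⟦ u ⟧ ≐ ⋃ (∃ ⟦ Φ ⟧) (λ (p , _) → ⟦ p ⟧)

  -- Chains are nonempty here because the empty union is the empty set, which lacks the element that
  -- a separating filter must contain.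
  UnionClosed : ∀ {r} → Pred (Subset X) r → Set (x ⊔ r)
  UnionClosed Q = ∀ {Φ u} → Satisfiable ⟦ Φ ⟧ → ⟦ Φ ⟧ ⊆ Q → IsChain Φ → IsUnion Φ u → Q u

-- Zorn's lemma for properties closed under unions of chains.

module Zorn {x r : Level} (em : ExcludedMiddle (x ⊔ r)) (ext : Extensionality x 0ℓ)
            {X : Set x} (Q : Pred (Subset X) r) (Q-closed : UnionClosed Q)
            {p₀ : Subset X} (Qp₀ : Q p₀) where

  private
    em-x : ExcludedMiddle x
    em-x = lower-excludedMiddle x r em

    _≼?_ : ∀ (p q : Subset X) → Dec (p ≼ q)
    _ ≼? _ = em-x

  StrictExtension : Subset X → Set (x ⊔ r)
  StrictExtension p = ∃ λ q → Q q × p ≼ q × ¬ q ≼ p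

  -- A positive decision carries its witness, so excluded middle itself supplies the choice of an
  -- extension.
  step-by : ∀ {p} → Dec (StrictExtension p) → Subset X
  step-by         (yes (q , _)) = q
  step-by {p = p} (no _)        = p

  step : Subset X → Subset X
  step p = step-by {p} em

  step-inflationary : ∀ p → p ≼ step p
  step-inflationary p with em {StrictExtension p}
  ... | yes (_ , _ , p≼q , _) = p≼q
  ... | no _                  = id

  step-preserves-Q : ∀ {p} → Q p → Q (step p)
  step-preserves-Q {p} Qp with em {StrictExtension p}
  ... | yes (_ , Qq , _) = Qq
  ... | no _             = Qp

  step-fixed⇒maximal : ∀ {p} → step p ≼ p → ¬ StrictExtension p
  step-fixed⇒maximal {p} fixed with em {StrictExtension p}
  ... | yes (_ , _ , _ , q⋠p) = contradiction (λ {x} → fixed {x}) q⋠p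
  ... | no none               = none

  -- The least class containing `p₀` and closed under `step` and nonempty unions. `tower-chain`
  -- shows that it is a chain, which lets `Q-closed` apply to its unions.
  data Tower : Pred (Subset X) x where
    base  : Tower p₀
    next  : ∀ {p} → Tower p → Tower (step p)
    union : ∀ {Φ u} → Satisfiable ⟦ Φ ⟧ → ⟦ Φ ⟧ ⊆ Tower → IsUnion Φ u → Tower u

  base-least : ∀ {p} → Tower p → p₀ ≼ p
  base-least base = id
  base-least (next {p} t) = step-inflationary p ∘ base-least t
  base-least (union (p , p∈Φ) Φ⊆T (_ , ⋃⊆u)) x∈p₀ =
    ⋃⊆u ((p , p∈Φ) , base-least (Φ⊆T p∈Φ) x∈p₀)

  -- The extreme points of the Bourbaki-Witt argument.
  Extreme : Pred (Subset X) x
  Extreme p = ∀ {q} → Tower q → q ≼ p → ¬ p ≼ q → step q ≼ p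

  -- The choice made by `step` depends on the set itself, so equal extent is first turned into
  -- propositional equality; function extensionality enters here.
  step-cong-≼ : ∀ {p q} → p ≼ q → q ≼ p → step p ≼ step q
  step-cong-≼ {p} p≼q q≼p =
    subst (λ q → step p ≼ step q) (≼-antisym ext p≼q q≼p) id

  -- Induction on the membership of `q`. If `q` is strictly below `p`, extremality bounds `step q`;
  -- if it has the extent of `p`, the two steps agree. A union contains `step p` once a member does;
  -- otherwise every member is below `p`.
  extreme-comparable : ∀ {p} → Tower p → Extreme p → ∀ {q} → Tower q → q ≼ p ⊎ step p ≼ q
  extreme-comparable t _ base = inj₁ (base-least t)
  extreme-comparable {p} t ext-p (next {q} u) with extreme-comparable t ext-p u
  ... | inj₂ sp≼q = inj₂ (step-inflationary q ∘ sp≼q)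
  ... | inj₁ q≼p with p ≼? q
  ...   | yes p≼q = inj₂ (step-cong-≼ p≼q q≼p)
  ...   | no  p⋠q = inj₁ (ext-p u q≼p p⋠q)
  extreme-comparable {p} t ext-p (union {Φ} _ Φ⊆T (u⊆⋃ , ⋃⊆u))
    with em-x {∃ λ q → q ∈ ⟦ Φ ⟧ × step p ≼ q}
  ... | yes (q , q∈Φ , sp≼q) = inj₂ λ x∈sp → ⋃⊆u ((q , q∈Φ) , sp≼q x∈sp)
  ... | no none = inj₁ λ x∈u → let ((q , q∈Φ) , x∈q) = u⊆⋃ x∈u in
    [ (λ q≼p → q≼p x∈q)
    , (λ sp≼q → contradiction (q , q∈Φ , λ {x} → sp≼q {x}) none)
    ] (extreme-comparable t ext-p (Φ⊆T q∈Φ))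

  tower-extreme : ∀ {p} → Tower p → Extreme p
  tower-extreme base u _ p₀⋠q = contradiction (λ {x} → base-least u {x}) p₀⋠q
  tower-extreme (next {p} t) {q} u q≼sp sp⋠q
    with extreme-comparable t (tower-extreme t) u
  ... | inj₂ sp≼q = contradiction (λ {x} → sp≼q {x}) sp⋠q
  ... | inj₁ q≼p with p ≼? q
  ...   | yes p≼q = step-cong-≼ q≼p p≼q
  ...   | no  p⋠q = step-inflationary p ∘ tower-extreme t u q≼p p⋠q
  tower-extreme (union {Φ} _ Φ⊆T (u⊆⋃ , ⋃⊆u)) {q} v _ u⋠q
    with em-x {∃ λ p → p ∈ ⟦ Φ ⟧ × ¬ p ≼ q}
  ... | no none = contradiction
    (λ {x} x∈u → let ((p , p∈Φ) , x∈p) = u⊆⋃ x∈u in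
      decidable-stable (p ≼? q) (λ p⋠q → none (p , p∈Φ , p⋠q)) x∈p)
    u⋠q
  -- This member is extreme by induction and not below `q`, so comparability leaves only `q`
  -- strictly below it.
  ... | yes (p , p∈Φ , p⋠q) with extreme-comparable (Φ⊆T p∈Φ) (tower-extreme (Φ⊆T p∈Φ)) v
  ...   | inj₁ q≼p  = λ x∈sq → ⋃⊆u ((p , p∈Φ) , tower-extreme (Φ⊆T p∈Φ) v q≼p p⋠q x∈sq)
  ...   | inj₂ sp≼q = contradiction (λ {x} → sp≼q {x} ∘ step-inflationary p) p⋠q

  tower-chain : ∀ {p q} → Tower p → Tower q → p ≼ q ⊎ q ≼ p
  tower-chain {p} t u with extreme-comparable t (tower-extreme t) u
  ... | inj₁ q≼p  = inj₂ q≼p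
  ... | inj₂ sp≼q = inj₁ (sp≼q ∘ step-inflationary p)

  tower⊆Q : Tower ⊆ Q
  tower⊆Q base = Qp₀
  tower⊆Q (next t) = step-preserves-Q (tower⊆Q t)
  tower⊆Q (union sat Φ⊆T isUnion) =
    Q-closed sat (λ p∈Φ → tower⊆Q (Φ⊆T p∈Φ))
      (λ p∈Φ q∈Φ → tower-chain (Φ⊆T p∈Φ) (Φ⊆T q∈Φ)) isUnion

  -- The union `m` of the whole tower lies in the tower, so `step m` is one of the sets united and
  -- `step` cannot enlarge `m`.
  maximal : ∃ λ m → Q m × ¬ StrictExtension m
  maximal = m , tower⊆Q m∈Tower , step-fixed⇒maximal sm≼m
    where
    Tower? : Decidable Tower
    Tower? _ = em-x

    all : Subset (Subset X)
    all = does ∘ Tower?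

    ⋃all? : Decidable (⋃ (∃ ⟦ all ⟧) (λ (p , _) → ⟦ p ⟧))
    ⋃all? _ = em-x

    m : Subset X
    m = does ∘ ⋃all?

    m∈Tower : Tower m
    m∈Tower = union (p₀ , proj₂ (comprehension Tower?) base)
                    (proj₁ (comprehension Tower?)) (comprehension ⋃all?)

    sm≼m : step m ≼ m
    sm≼m x∈sm = proj₂ (comprehension ⋃all?)
      ((step m , proj₂ (comprehension Tower?) (next m∈Tower)) , x∈sm)

-- Separation by prime filters.

module PrimeFilterTheorem
  {c ℓ₁ ℓ₂ : Level} (em : ExcludedMiddle (c ⊔ ℓ₁ ⊔ ℓ₂)) (ext : Extensionality c 0ℓ)
  (A : BoundedDistributiveLattice c ℓ₁ ℓ₂) where

  open BoundedDistributiveLattice A hiding (refl)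
  open Poset poset using () renaming (refl to ≤-refl)
  open MeetSemilatticeProperties meetSemilattice using (∧-monotonic)

  record SeparatingFilter {r} (a b : Carrier) (F : Pred Carrier r) : Set (c ⊔ ℓ₂ ⊔ r) where
    field
      contains : a ∈ F
      omits    : b ∉ F
      upward   : ∀ {x y} → x ≤ y → x ∈ F → y ∈ F
      ∧-closed : ∀ {x y} → x ∈ F → y ∈ F → x ∧ y ∈ F

  open SeparatingFilter

  SeparatingFilter-resp-≐ : ∀ {r s a b} {F : Pred Carrier r} {G : Pred Carrier s} →
                            F ≐ G → SeparatingFilter a b F → SeparatingFilter a b G
  SeparatingFilter-resp-≐ (F⊆G , G⊆F) sep = record
    { contains = F⊆G (contains sep)
    ; omits    = omits sep ∘ G⊆F
    ; upward   = λ x≤y x∈G → F⊆G (upward sep x≤y (G⊆F x∈G))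
    ; ∧-closed = λ x∈G y∈G → F⊆G (∧-closed sep (G⊆F x∈G) (G⊆F y∈G))
    }

  ↑-separating : ∀ {a b} → ¬ a ≤ b → SeparatingFilter a b (a ≤_)
  ↑-separating a≰b = record
    { contains = ≤-refl
    ; omits    = a≰b
    ; upward   = λ x≤y a≤x → trans a≤x x≤y
    ; ∧-closed = ∧-greatest
    }

  -- For meets, two elements of the union both lie in the larger of the two members containing them,
  -- since the family is a chain.
  separating-unionClosed : ∀ {a b} → UnionClosed (λ p → SeparatingFilter a b ⟦ p ⟧)
  separating-unionClosed {a} {b} {Φ} (p , p∈Φ) Φ⊆Q chain (u⊆⋃ , ⋃⊆u) =
    SeparatingFilter-resp-≐ (⋃⊆u , u⊆⋃) (record
      { contains = (p , p∈Φ) , contains (Φ⊆Q p∈Φ)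
      ; omits    = λ ((_ , q∈Φ) , b∈q) → omits (Φ⊆Q q∈Φ) b∈q
      ; upward   = λ x≤y ((q , q∈Φ) , x∈q) → (q , q∈Φ) , upward (Φ⊆Q q∈Φ) x≤y x∈q
      ; ∧-closed = λ ((q , q∈Φ) , x∈q) ((r , r∈Φ) , y∈r) →
          [ (λ q≼r → (r , r∈Φ) , ∧-closed (Φ⊆Q r∈Φ) (q≼r x∈q) y∈r)
          , (λ r≼q → (q , q∈Φ) , ∧-closed (Φ⊆Q q∈Φ) x∈q (r≼q y∈r))
          ] (chain q∈Φ r∈Φ)
      })

  -- For a filter `F`, this is the filter generated by `F` and `x`.
  adjoin : ∀ {r} → Pred Carrier r → Carrier → Pred Carrier (c ⊔ ℓ₂ ⊔ r)
  adjoin F x z = ∃ λ w → w ∈ F × w ∧ x ≤ z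

  adjoin-separating : ∀ {r a b x} {F : Pred Carrier r} → SeparatingFilter a b F →
                      b ∉ adjoin F x → SeparatingFilter a b (adjoin F x)
  adjoin-separating {a = a} {x = x} sep b∉ = record
    { contains = a , contains sep , x∧y≤x a x
    ; omits    = b∉
    ; upward   = λ y≤z (w , w∈F , w∧x≤y) → w , w∈F , trans w∧x≤y y≤z
    ; ∧-closed = λ (v , v∈F , v∧x≤y) (w , w∈F , w∧x≤z) →
        v ∧ w , ∧-closed sep v∈F w∈F ,
        ∧-greatest (trans (∧-monotonic (x∧y≤x v w) ≤-refl) v∧x≤y)
                   (trans (∧-monotonic (x∧y≤y v w) ≤-refl) w∧x≤z)
    }

  -- Distributivity of the lattice enters here; it is what makes a maximal separating filter prime.
  ∧-∨-bound : ∀ {v w x y b} → v ∧ x ≤ b → w ∧ y ≤ b → (v ∧ w) ∧ (x ∨ y) ≤ b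
  ∧-∨-bound {v} {w} {x} {y} v∧x≤b w∧y≤b =
    trans (reflexive (∧-distribˡ-∨ (v ∧ w) x y))
      (∨-least (trans (∧-monotonic (x∧y≤x v w) ≤-refl) v∧x≤b)
               (trans (∧-monotonic (x∧y≤y v w) ≤-refl) w∧y≤b))

  separation : ∀ {a b} → ¬ a ≤ b → ∃ λ (F : PriestleySpace A) → a ∈ proj₁ F × b ∉ proj₁ F
  separation {a} {b} a≰b = (Lift _ ∘ ⟦ m ⟧ , isPrimeFilter) , lift (contains sep) , omits sep ∘ lower
    where
    em-ℓ₂ : ExcludedMiddle ℓ₂
    em-ℓ₂ = lower-excludedMiddle ℓ₂ (c ⊔ ℓ₁) em

    em-cℓ₂ : ExcludedMiddle (c ⊔ ℓ₂)
    em-cℓ₂ = lower-excludedMiddle (c ⊔ ℓ₂) ℓ₁ em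

    ↑a? : Decidable (a ≤_)
    ↑a? _ = em-ℓ₂

    p₀-separating : SeparatingFilter a b ⟦ does ∘ ↑a? ⟧
    p₀-separating = SeparatingFilter-resp-≐
      (proj₂ (comprehension ↑a?) , proj₁ (comprehension ↑a?)) (↑-separating a≰b)

    open Zorn em-cℓ₂ ext (λ p → SeparatingFilter a b ⟦ p ⟧) separating-unionClosed p₀-separating
      using (maximal)

    m : Subset Carrier
    m = proj₁ maximal

    sep : SeparatingFilter a b ⟦ m ⟧
    sep = proj₁ (proj₂ maximal)

    -- Otherwise the filter generated by `m` and `x` would still separate, and would strictly extend
    -- the maximal `m`.
    adjoin-∋b : ∀ {x} → x ∉ ⟦ m ⟧ → b ∈ adjoin ⟦ m ⟧ x
    adjoin-∋b {x} x∉m = decidable-stable em-cℓ₂ λ b∉ →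
      proj₂ (proj₂ maximal)
        ( does ∘ adjoin?
        , SeparatingFilter-resp-≐ (from , to) (adjoin-separating sep b∉)
        , (λ {z} z∈m → from (z , z∈m , x∧y≤x z x))
        , λ q≼m → x∉m (q≼m (from (a , contains sep , x∧y≤y a x)))
        )
      where
      adjoin? : Decidable (adjoin ⟦ m ⟧ x)
      adjoin? _ = em-cℓ₂

      to : ⟦ does ∘ adjoin? ⟧ ⊆ adjoin ⟦ m ⟧ x
      to = proj₁ (comprehension adjoin?)

      from : adjoin ⟦ m ⟧ x ⊆ ⟦ does ∘ adjoin? ⟧
      from = proj₂ (comprehension adjoin?)

    prime : ∀ {x y} → x ∨ y ∈ ⟦ m ⟧ → x ∈ ⟦ m ⟧ ⊎ y ∈ ⟦ m ⟧
    prime {x} {y} x∨y∈m with lower-excludedMiddle 0ℓ (c ⊔ ℓ₂) em-cℓ₂ {x ∈ ⟦ m ⟧}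
                           | lower-excludedMiddle 0ℓ (c ⊔ ℓ₂) em-cℓ₂ {y ∈ ⟦ m ⟧}
    ... | yes x∈m | _       = inj₁ x∈m
    ... | no _    | yes y∈m = inj₂ y∈m
    ... | no x∉m  | no y∉m  =
      -- Both generated filters reach `b`; the meet of the two witnesses with `x ∨ y` lies in `m`
      -- and below `b`.
      let (_ , v∈m , v∧x≤b) = adjoin-∋b x∉m
          (_ , w∈m , w∧y≤b) = adjoin-∋b y∉m
      in contradiction
           (upward sep (∧-∨-bound v∧x≤b w∧y≤b) (∧-closed sep (∧-closed sep v∈m w∈m) x∨y∈m))
           (omits sep)

    isPrimeFilter : IsPrimeFilter A (Lift (c ⊔ ℓ₁ ⊔ ℓ₂) ∘ ⟦ m ⟧)
    isPrimeFilter = record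
      { ⊤-mem    = lift (upward sep (maximum a) (contains sep))
      ; upward   = λ x≤y (lift x∈m) → lift (upward sep x≤y x∈m)
      ; ∧-closed = λ (lift x∈m) (lift y∈m) → lift (∧-closed sep x∈m y∈m)
      ; proper   = λ (lift ⊥∈m) → omits sep (upward sep (minimum b) ⊥∈m)
      ; prime    = λ (lift x∨y∈m) → [ inj₁ ∘ lift , inj₂ ∘ lift ] (prime x∨y∈m)
      }

-- Distributive joins and closures in the Priestley space.

theorem5p16 : ∀ {c ℓ₁ ℓ₂} →
    ExcludedMiddle (suc (c ⊔ ℓ₁ ⊔ ℓ₂)) →
    Extensionality (c ⊔ ℓ₁ ⊔ ℓ₂) (c ⊔ ℓ₁ ⊔ ℓ₂) →
    (A : BoundedDistributiveLattice c ℓ₁ ℓ₂) →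
    let open BoundedDistributiveLattice A using (Carrier) in
    (S : Pred Carrier (c ⊔ ℓ₁ ⊔ ℓ₂)) (⋁S : Carrier) →
    IsJoin A S ⋁S →
    IsDistributive A S ⋁S ⇔ (𝔰 A ⋁S ≐ cl A (⋃ (∃ S) (λ (s , _) → 𝔰 A s)))
theorem5p16 {c} {ℓ₁} {ℓ₂} em ext A S ⋁S (upper , _) = mk⇔ to from
  where
  open BoundedDistributiveLattice A hiding (refl)
  open Poset poset using () renaming (refl to ≤-refl)
  open MeetSemilatticeProperties meetSemilattice using (∧-monotonic)
  open IsPrimeFilter

  ℓ : Level
  ℓ = c ⊔ ℓ₁ ⊔ ℓ₂

  em-ℓ : ExcludedMiddle ℓ
  em-ℓ = lower-excludedMiddle ℓ (suc ℓ) em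

  em-ℓ₂ : ExcludedMiddle ℓ₂
  em-ℓ₂ = lower-excludedMiddle ℓ₂ ℓ em-ℓ

  open PrimeFilterTheorem em-ℓ (lower-extensionality ℓ ℓ ext) A using (separation)

  ⋃𝔰 : Pred (PriestleySpace A) ℓ
  ⋃𝔰 = ⋃ (∃ S) (λ (s , _) → 𝔰 A s)

  ≤-from-primeFilters : ∀ {a b} → 𝔰 A a ⊆ 𝔰 A b → a ≤ b
  ≤-from-primeFilters 𝔰a⊆𝔰b = decidable-stable em-ℓ₂ λ a≰b →
    let (F , a∈F , b∉F) = separation a≰b in b∉F (𝔰a⊆𝔰b {F} a∈F)

  𝔰-closed : ∀ a → IsClosed A (𝔰 A a)
  -- Every prime filter contains `⊤`, so the complement of `𝔰 A a` is the basic set of `(⊤ , a)`.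
  𝔰-closed a {F , isPF} a∉F = (⊤ , a) , (⊤-mem isPF , a∉F) , proj₂

  ∁basic-closed : ∀ k → IsClosed A (∁ (basic A k))
  ∁basic-closed k ¬¬∈ = k , decidable-stable em-ℓ ¬¬∈ , λ ∈k ∉k → ∉k ∈k

  to : IsDistributive A S ⋁S → 𝔰 A ⋁S ≐ cl A ⋃𝔰
  to distributive = 𝔰⊆cl , λ F∈cl → F∈cl (𝔰 A ⋁S) (λ {G} → 𝔰-closed ⋁S {G})
    λ { {_ , isPF} ((_ , s∈S) , s∈F) → upward isPF (upper s∈S) s∈F }
    where
    𝔰⊆cl : 𝔰 A ⋁S ⊆ cl A ⋃𝔰
    𝔰⊆cl {F , isPF} ⋁S∈F C closed ⋃⊆C = decidable-stable em-ℓ λ F∉C →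
      -- A basic neighbourhood of `F` outside `C` misses every `𝔰 A s`, which makes `b` an upper
      -- bound of the meets `a ∧ s`.
      let ((a , b) , (a∈F , b∉F) , basic⊆∁C) = closed F∉C
          a∧s≤b : ∀ {y} → y ∈ meetWith A a S → y ≤ b
          a∧s≤b = λ { (s , s∈S , y≈a∧s) → trans (reflexive y≈a∧s) (≤-from-primeFilters
            λ { {G , isPG} a∧s∈G → decidable-stable em-ℓ λ b∉G →
                basic⊆∁C {G , isPG} (upward isPG (x∧y≤x a s) a∧s∈G , b∉G)
                         (⋃⊆C ((s , s∈S) , upward isPG (x∧y≤y a s) a∧s∈G)) }) }
      in b∉F (upward isPF (proj₂ (distributive a) a∧s≤b) (∧-closed isPF a∈F ⋁S∈F))

  from : 𝔰 A ⋁S ≐ cl A ⋃𝔰 → IsDistributive A S ⋁S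
  from (𝔰⊆cl , _) a =
      (λ (s , s∈S , y≈a∧s) → trans (reflexive y≈a∧s) (∧-monotonic ≤-refl (upper s∈S)))
    , λ {u} a∧s≤u → ≤-from-primeFilters λ { {F , isPF} a∧⋁S∈F → decidable-stable em-ℓ λ u∉F →
        -- The closed set tested is the complement of the basic set of `(a , u)`: it contains every
        -- `𝔰 A s` because `a ∧ s ≤ u`, yet it omits `F`.
        𝔰⊆cl {F , isPF} (upward isPF (x∧y≤y a ⋁S) a∧⋁S∈F)
          (∁ (basic A (a , u))) (λ {G} → ∁basic-closed (a , u) {G})
          (λ { {_ , isPG} ((s , s∈S) , s∈G) (a∈G , u∉G) →
               u∉G (upward isPG (a∧s≤u (s , s∈S , Eq.refl)) (∧-closed isPG a∈G s∈G)) })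
          (upward isPF (x∧y≤x a ⋁S) a∧⋁S∈F , u∉F) }
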